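{- Let $G$ be a simple 2-connected graph of order $n\ge 10$. If $G$ is $\{K_{1,3}, Z_2\}$-free, then either $G$ is the cycle $C_n$ or $G$ is chorded pancyclic.
   Context: For graphs $H_1,\dots,H_r$, $G$ is $\{H_1,\dots,H_r\}$-free if $G$ contains no induced subgraph isomorphic to any $H_i$. $K_{1,3}$ is the claw (star with three leaves). $P_i$ denotes the path on $i$ vertices, and $Z_i$ denotes the graph obtained from a triangle by attaching a pendant path $P_i$ to one vertex of the triangle (i.e., one endpoint of a path on $i$ new vertices is joined by an edge to one triangle vertex); so $Z_2$ has 5 vertices. A chorded cycle is a cycle $C$ such that $G$ has an edge joining two vertices nonconsecutive on $C$. A graph $G$ of order $n$ is chorded pancyclic if it contains a chorded cycle of every length $m$ with $4\le m\le n$. -}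

module Defs where

open import Data.Nat using (ℕ; zero; suc; _≤_)
open import Data.Bool using (Bool; true; false; _∨_)
open import Data.Fin using (Fin; toℕ)
open import Data.Product using (Σ; _×_; _,_; ∃)
open import Data.Sum using (_⊎_)
open import Data.Unit using (⊤)
open import Relation.Nullary using (¬_)
open import Relation.Binary.PropositionalEquality using (_≡_; _≢_)
open import Function using (Injective; Bijective)

record Graph (n : ℕ) : Set where
  field
    adj    : Fin n → Fin n → Bool
    sym    : ∀ i j → adj i j ≡ adj j i
    irrefl : ∀ i → adj i i ≡ false

open Graph public

Adj : ∀ {n} → Graph n → Fin n → Fin n → Set
Adj G i j = adj G i j ≡ true

data ReachIn {n} (G : Graph n) (S : Fin n → Set) : Fin n → Fin n → Set where
  here : ∀ {u} → S u → ReachIn G S u u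
  step : ∀ {u v w} → S u → Adj G u v → ReachIn G S v w → ReachIn G S u w

Connected : ∀ {n} → Graph n → Set
Connected {n} G = ∀ (u w : Fin n) → ReachIn G (λ _ → ⊤) u w

TwoConnected : ∀ {n} → Graph n → Set
TwoConnected {n} G =
  (3 ≤ n) × Connected G ×
  (∀ (v u w : Fin n) → u ≢ v → w ≢ v → ReachIn G (λ x → x ≢ v) u w)

-- G contains an induced subgraph isomorphic to the graph H on Fin k
-- (H given by a symmetric, irreflexive Bool adjacency function).
InducedCopy : ∀ {k n} → (Fin k → Fin k → Bool) → Graph n → Set
InducedCopy {k} {n} H G =
  Σ (Fin k → Fin n) λ f → Injective _≡_ _≡_ f ×
    (∀ i j → (H i j ≡ true → Adj G (f i) (f j)) × (Adj G (f i) (f j) → H i j ≡ true))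

private
  clawE : ℕ → ℕ → Bool
  clawE 0 1 = true
  clawE 0 2 = true
  clawE 0 3 = true
  clawE _ _ = false

  -- Z₂: triangle 0,1,2 with pendant path 3-4 attached at 0 (edges 0-3, 3-4).
  z2E : ℕ → ℕ → Bool
  z2E 0 1 = true
  z2E 0 2 = true
  z2E 1 2 = true
  z2E 0 3 = true
  z2E 3 4 = true
  z2E _ _ = false

claw : Fin 4 → Fin 4 → Bool
claw i j = clawE (toℕ i) (toℕ j) ∨ clawE (toℕ j) (toℕ i)

Z₂ : Fin 5 → Fin 5 → Bool
Z₂ i j = z2E (toℕ i) (toℕ j) ∨ z2E (toℕ j) (toℕ i)

CycSucc : (m : ℕ) → Fin m → Fin m → Set
CycSucc m i j = (suc (toℕ i) ≡ toℕ j) ⊎ ((suc (toℕ i) ≡ m) × (toℕ j ≡ 0))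

CycAdj : (m : ℕ) → Fin m → Fin m → Set
CycAdj m i j = CycSucc m i j ⊎ CycSucc m j i

IsCycle : ∀ {n} → Graph n → (m : ℕ) → (Fin m → Fin n) → Set
IsCycle G m c = (3 ≤ m) × Injective _≡_ _≡_ c × (∀ i j → CycSucc m i j → Adj G (c i) (c j))

HasChord : ∀ {n} → Graph n → (m : ℕ) → (Fin m → Fin n) → Set
HasChord G m c = ∃ λ i → ∃ λ j → i ≢ j × ¬ CycAdj m i j × Adj G (c i) (c j)

ChordedPancyclic : ∀ {n} → Graph n → Set
ChordedPancyclic {n} G =
  ∀ m → 4 ≤ m → m ≤ n → Σ (Fin m → Fin n) λ c → IsCycle G m c × HasChord G m c

IsCycleGraph : ∀ {n} → Graph n → Set
IsCycleGraph {n} G =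
  Σ (Fin n → Fin n) λ f → Bijective _≡_ _≡_ f ×
    (∀ i j → (CycAdj n i j → Adj G (f i) (f j)) × (Adj G (f i) (f j) → CycAdj n i j))

-- Every cycle C on m vertices with 4 ≤ m < n gives a chorded cycle on m + 1
-- vertices.  Let x off C be adjacent to c on C, and let c⁻, c⁺ be the neighbours
-- of c on C.  If x ~ c⁺, insert x, and c c⁺ becomes a chord; otherwise claw-freeness
-- gives c⁻ ~ c⁺.  If x has a second neighbour d on C, then Z₂-freeness applied to the
-- triangle x c d forces a rerouting of C through c x d.  If no vertex off C has two
-- neighbours on C, then Z₂-freeness shows that all vertices reached from x avoiding c
-- stay off C and are attached to it only at c, against 2-connectedness.
--
-- A diamond is a chorded 4-cycle to start from.  In a graph without diamonds a triangle
-- dominates G by Z₂-freeness, and each of its vertices has at most two neighbours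
-- outside it by claw-freeness, so that n ≤ 3 + 3 · 2.  Without triangles, any cycle has
-- at least four vertices, so it grows to a Hamiltonian cycle, which has no chord by
-- claw-freeness.
module Submission where

open import Defs
open import Data.Nat using (ℕ; _≤_)
open import Data.Sum using (_⊎_)
open import Relation.Nullary using (¬_)
open import Data.Nat as ℕ using (zero; suc; _+_; _<_; z≤n; s≤s)
import Data.Nat.Properties as ℕₚ
open import Data.Bool using (true; false)
import Data.Bool.Properties as Boolₚ
open import Data.Fin using (Fin; zero; suc; toℕ; fromℕ; fromℕ<; inject₁)
import Data.Fin.Properties as Finₚ
open import Data.List using (List; []; _∷_; _++_; length; lookup; reverse; filter; allFin)
import Data.List.Properties as Listₚ
open import Data.List.Membership.Propositional using (_∈_; _∉_)
import Data.List.Membership.DecPropositional as DecMembership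
import Data.List.Membership.Propositional.Properties as ∈ₚ
open import Data.List.Relation.Unary.All using (All; []; _∷_)
import Data.List.Relation.Unary.All.Properties as Allₚ
open import Data.List.Relation.Unary.Any as Any using (Any; here; there)
import Data.List.Relation.Unary.Any.Properties as Anyₚ
open import Data.List.Relation.Unary.AllPairs using ([]; _∷_; tail)
open import Data.List.Relation.Unary.Unique.Propositional using (Unique)
open import Data.List.Relation.Unary.Unique.Propositional.Properties
  using (Unique[x∷xs]⇒x∉xs; filter⁺; allFin⁺; tabulate⁺)
open import Data.List.Relation.Binary.Permutation.Propositional
  using (_↭_; ↭-refl; ↭-sym; ↭⇒↭ₛ; prep; swap)
import Data.List.Relation.Binary.Permutation.Propositional.Properties as ↭ₚ
import Data.List.Relation.Binary.Permutation.Setoid.Properties as ↭ₛ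
import Algebra.Solver.CommutativeMonoid as CommutativeMonoidSolver
open import Data.Product using (Σ; ∃; _×_; _,_)
open import Data.Sum using (inj₁; inj₂)
open import Data.Unit using (⊤)
open import Data.Empty using (⊥; ⊥-elim)
open import Function using (Injective; Surjective; _∘_; id)
open import Relation.Nullary using (Dec; yes; no)
open import Relation.Nullary.Decidable using (_→-dec_; _⊎-dec_; _×-dec_; ¬?; from-yes)
open import Relation.Binary.PropositionalEquality as ≡
  using (_≡_; _≢_; refl; trans; cong; subst)

-- Lists without repetition.

private
  variable
    A R : Set
    k l : List A
    x y : A

Unique-resp-↭ : k ↭ l → Unique k → Unique l
Unique-resp-↭ k↭l u = ↭ₛ.Unique-resp-↭ (≡.setoid _) (↭⇒↭ₛ k↭l) u

∉⇒Unique : x ∉ l → Unique l → Unique (x ∷ l)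
∉⇒Unique x∉l u = Allₚ.¬Any⇒All¬ _ x∉l ∷ u

lookup-injective : Unique l → Injective _≡_ _≡_ (lookup l)
lookup-injective {l = _ ∷ _} (_ ∷ _) {zero} {zero} _ = refl
lookup-injective {l = _ ∷ l} u {zero} {suc j} eq =
  ⊥-elim (Unique[x∷xs]⇒x∉xs u (subst (_∈ l) (≡.sym eq) (∈ₚ.∈-lookup j)))
lookup-injective {l = _ ∷ l} u {suc i} {zero} eq =
  ⊥-elim (Unique[x∷xs]⇒x∉xs u (subst (_∈ l) eq (∈ₚ.∈-lookup i)))
lookup-injective {l = _ ∷ _} (_ ∷ u) {suc i} {suc j} eq =
  cong suc (lookup-injective u eq)

lookup-++ : ∀ (k : List A) {e l} →
            Σ (Fin (length (k ++ e ∷ l))) λ i → toℕ i ≡ length k × lookup (k ++ e ∷ l) i ≡ e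
lookup-++ [] = zero , refl , refl
lookup-++ (_ ∷ k) with i , eq , eq′ ← lookup-++ k = suc i , cong suc eq , eq′

covers⇒≤ : ∀ {n} {l : List (Fin n)} → (∀ v → v ∈ l) → n ≤ length l
covers⇒≤ {l = l} ∈l = Finₚ.injective⇒≤ {f = Any.index ∘ ∈l} λ {v} {w} eq →
  trans (Anyₚ.lookup-index (∈l v))
        (trans (cong (lookup l) eq) (≡.sym (Anyₚ.lookup-index (∈l w))))

uncovered : ∀ {n} (l : List (Fin n)) → length l < n → ∃ (_∉ l)
uncovered {n} l short = Finₚ.¬∀⟶∃¬ n _ (_∈? l) (ℕₚ.<⇒≱ short ∘ covers⇒≤)
  where open DecMembership (Finₚ._≟_ {n}) using (_∈?_)

length-++≥2 : ∀ (k : List A) → 2 ≤ length (k ++ x ∷ y ∷ l)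
length-++≥2 []      = s≤s (s≤s z≤n)
length-++≥2 (_ ∷ k) = ℕₚ.m≤n⇒m≤1+n (length-++≥2 k)

-- Consecutive positions on a cycle.

zero≢ : ∀ {m k} {j : Fin (suc m)} → toℕ j ≡ k → 2 ≤ k → zero ≢ j
zero≢ refl () refl

-- Positions 0 and `k` cut the cycle into arcs of `k` and `l` edges, and neither arc is a single
-- edge.
not-consecutive : ∀ {m k l} {j : Fin (suc m)} → toℕ j ≡ k → suc m ≡ k + l → 2 ≤ k → 2 ≤ l →
                  ¬ CycAdj (suc m) zero j
not-consecutive j≡k _ 2≤k _ (inj₁ (inj₁ 1≡j))       = ℕₚ.<⇒≢ 2≤k (trans 1≡j j≡k)
not-consecutive j≡k _ 2≤k _ (inj₁ (inj₂ (_ , j≡0))) =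
  ℕₚ.<⇒≢ (ℕₚ.<⇒≤ 2≤k) (trans (≡.sym j≡0) j≡k)
not-consecutive refl m≡ 2≤k 2≤l (inj₂ (inj₂ (last , _))) =
  ℕₚ.1+n≰n (subst (2 ≤_) (ℕₚ.+-cancelˡ-≡ _ _ 1
    (trans (≡.sym m≡) (trans (≡.sym last) (ℕₚ.+-comm 1 _)))) 2≤l)

successor : ∀ {m} (i : Fin m) → ∃ (CycSucc m i)
successor {suc m} i with suc (toℕ i) ℕₚ.<? suc m
... | yes i<m = fromℕ< i<m , inj₁ (≡.sym (Finₚ.toℕ-fromℕ< i<m))
... | no i≮m  = zero , inj₂ (ℕₚ.≤-antisym (Finₚ.toℕ<n i) (ℕₚ.≮⇒≥ i≮m) , refl)

predecessor : ∀ {m} (i : Fin m) → ∃ λ j → CycSucc m j i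
predecessor {suc m} zero    = fromℕ m , inj₂ (cong suc (Finₚ.toℕ-fromℕ m) , refl)
predecessor {suc m} (suc i) = inject₁ i , inj₁ (cong suc (Finₚ.toℕ-inject₁ i))

no-2-cycle : ∀ {m} {i j : Fin m} → 3 ≤ m → CycSucc m i j → CycSucc m j i → ⊥
no-2-cycle {m} {i} {j} = go (toℕ i) (toℕ j)
  where
  -- `CycSucc` restated for variables in ℕ, so that its equations can be eliminated by matching on
  -- `refl`.
  Follows : ℕ → ℕ → Set
  Follows i j = (suc i ≡ j) ⊎ ((suc i ≡ m) × (j ≡ 0))
  go : ∀ i j → 3 ≤ m → Follows i j → Follows j i → ⊥
  go i j _ (inj₁ refl) (inj₁ eq) = ℕₚ.<-irrefl (≡.sym eq) (ℕₚ.m≤n⇒m≤1+n ℕₚ.≤-refl)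
  go i j 3≤m (inj₁ refl) (inj₂ (refl , refl)) with s≤s (s≤s ()) ← 3≤m
  go i j 3≤m (inj₂ (refl , refl)) (inj₁ refl) with s≤s (s≤s ()) ← 3≤m
  go i j 3≤m (inj₂ (refl , refl)) (inj₂ (_ , refl)) with s≤s () ← 3≤m

consecutive? : ∀ {m} (i j : Fin m) → Dec (CycAdj m i j)
consecutive? {m} i j = follows? i j ⊎-dec follows? j i
  where
  follows? : ∀ i j → Dec (CycSucc m i j)
  follows? i j = (suc (toℕ i) ℕₚ.≟ toℕ j) ⊎-dec
    ((suc (toℕ i) ℕₚ.≟ m) ×-dec (toℕ j ℕₚ.≟ 0))

-- Makes a map that preserves and reflects adjacency from `Z₂` automatically injective. The claw
-- lacks this property, as its leaves have equal rows.
Z₂-rows-distinct : ∀ i j → (∀ k → Z₂ i k ≡ Z₂ j k) → i ≡ j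
Z₂-rows-distinct = from-yes (Finₚ.all? λ i → Finₚ.all? λ j →
  Finₚ.all? (λ k → Z₂ i k Boolₚ.≟ Z₂ j k) →-dec (i Finₚ.≟ j))

-- Adjacency, and walks and cycles given by their vertex lists.

module InGraph {n : ℕ} (G : Graph n) where

  private
    V : Set
    V = Fin n
    variable
      a b c d p q r s u v w : V
      m : ℕ

  open DecMembership (Finₚ._≟_ {n}) using (_∈?_)

  infix 4 _~_
  _~_ : V → V → Set
  u ~ v = Adj G u v

  ~-sym : u ~ v → v ~ u
  ~-sym {u} {v} uv = trans (sym G v u) uv

  ~⇒≢ : u ~ v → u ≢ v
  ~⇒≢ {u} uv refl with () ← trans (≡.sym uv) (irrefl G u)

  _~?_ : ∀ u v → Dec (u ~ v)
  u ~? v = adj G u v Boolₚ.≟ true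

  byAdjacency : ∀ u v → (u ~ v → R) → (adj G u v ≡ false → R) → R
  byAdjacency u v yes-case no-case with adj G u v
  ... | true  = yes-case refl
  ... | false = no-case refl

  start≢ : ReachIn G (_≢ c) u w → u ≢ c
  start≢ (here u≢)     = u≢
  start≢ (step u≢ _ _) = u≢

  data Walk : V → List V → V → Set where
    [_] : ∀ u → Walk u (u ∷ []) u
    _∷_ : u ~ v → Walk v l w → Walk u (u ∷ l) w

  join : Walk u k v → v ~ w → Walk w l q → Walk u (k ++ l) q
  join [ _ ]    vw W′ = vw ∷ W′
  join (e ∷ W) vw W′ = e ∷ join W vw W′

  reverseWalk : Walk u l v → Walk v (reverse l) u
  reverseWalk [ u ] = [ u ]
  reverseWalk {u} {u ∷ l} {v} (e ∷ W) = subst (λ l′ → Walk v l′ u)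
    (≡.sym (Listₚ.unfold-reverse u l)) (join (reverseWalk W) (~-sym e) [ u ])

  source∈ : Walk u l v → u ∈ l
  source∈ [ _ ]   = here refl
  source∈ (_ ∷ _) = here refl

  target∈ : Walk u l v → v ∈ l
  target∈ [ _ ]   = here refl
  target∈ (_ ∷ W) = there (target∈ W)

  nonempty : Walk u l v → 1 ≤ length l
  nonempty [ _ ]   = s≤s z≤n
  nonempty (_ ∷ _) = s≤s z≤n

  ends-distinct : Walk u l v → 2 ≤ length l → Unique l → u ≢ v
  ends-distinct [ _ ] (s≤s ()) _
  ends-distinct (_ ∷ W) _ un refl = Unique[x∷xs]⇒x∉xs un (target∈ W)

  record Split (u : V) (l : List V) (v d : V) : Set where
    constructor mkSplit
    field
      {before after} : List V
      {pred succ}    : V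
      left           : Walk u before pred
      pred~d         : pred ~ d
      d~succ         : d ~ succ
      right          : Walk succ after v
      split≡         : l ≡ before ++ d ∷ after

  split : Walk u l v → d ∈ l → d ≢ u → d ≢ v → Split u l v d
  split [ _ ]   (here refl) d≢u _ = ⊥-elim (d≢u refl)
  split (_ ∷ _) (here refl) d≢u _ = ⊥-elim (d≢u refl)
  split {d = d} (_∷_ {v = s} e W) (there d∈) d≢u d≢v with d Finₚ.≟ s
  split (e ∷ [ _ ])   (there d∈) _ d≢v | yes refl = ⊥-elim (d≢v refl)
  split (e ∷ e′ ∷ W) (there d∈) _ d≢v | yes refl = mkSplit [ _ ] e e′ W refl
  ... | no d≢s with mkSplit L pd ds W′ refl ← split W d∈ d≢s d≢v =
    mkSplit (e ∷ L) pd ds W′ refl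

  -- A cycle through c on m vertices, with neighbours s and p of c on it;
  -- l lists the other vertices from s to p.
  record Cycle (m : ℕ) (c s p : V) (l : List V) : Set where
    constructor mkCycle
    field
      walk   : Walk s l p
      c~s    : c ~ s
      p~c    : p ~ c
      unique : Unique (c ∷ l)
      size   : suc (length l) ≡ m

  open Cycle

  reverseCycle : Cycle m c s p l → Cycle m c p s (reverse l)
  reverseCycle {c = c} {l = l} C = mkCycle (reverseWalk (walk C)) (~-sym (p~c C)) (~-sym (c~s C))
    (Unique-resp-↭ (prep c (↭-sym (↭ₚ.↭-reverse l))) (unique C))
    (trans (cong suc (Listₚ.length-reverse l)) (size C))

  ∉-reverse : x ∉ c ∷ l → x ∉ c ∷ reverse l
  ∉-reverse {c = c} {l = l} x∉ = x∉ ∘ ↭ₚ.∈-resp-↭ (prep c (↭ₚ.↭-reverse l))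

  -- The equation `l≡` is kept so that membership in the whole vertex list can be carried over to
  -- the cycle based at `c`.
  record Through (m : ℕ) (c p : V) (l : List V) : Set where
    constructor mkThrough
    field
      {next} : V
      {rest} : List V
      l≡     : l ≡ c ∷ rest
      cycle  : Cycle m c next p rest

  closeUp : 2 ≤ m → Walk c l p → p ~ c → Unique l → length l ≡ m → Through m c p l
  closeUp (s≤s ()) [ _ ] _ _ refl
  closeUp _ (cs ∷ W) pc un len = mkThrough refl (mkCycle W cs pc un len)

  -- Two vertex-disjoint walks x₁…y₁ and x₂…y₂ closed up by y₁x₂ and y₂x₁ into a
  -- cycle with chord x₁x₂.
  record ChordedCycle (m : ℕ) : Set where
    constructor mkChorded
    field
      {x₁ y₁ x₂ y₂} : V
      {l₁ l₂}       : List V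
      walk₁         : Walk x₁ l₁ y₁
      y₁~x₂         : y₁ ~ x₂
      walk₂         : Walk x₂ l₂ y₂
      y₂~x₁         : y₂ ~ x₁
      x₁~x₂         : x₁ ~ x₂
      long₁         : 2 ≤ length l₁
      long₂         : 2 ≤ length l₂
      unique        : Unique (l₁ ++ l₂)
      size          : length (l₁ ++ l₂) ≡ m

  source-first : Walk u l v → ∃ λ t → l ≡ u ∷ t
  source-first [ _ ]   = _ , refl
  source-first (_ ∷ _) = _ , refl

  lookup-first : Walk u l v → ∀ j → toℕ j ≡ 0 → lookup l j ≡ u
  lookup-first [ _ ]   zero _ = refl
  lookup-first (_ ∷ _) zero _ = refl

  lookup-last : Walk u l v → ∀ i → suc (toℕ i) ≡ length l → lookup l i ≡ v
  lookup-last [ _ ]         zero    _  = refl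
  lookup-last (_ ∷ [ _ ])   zero    ()
  lookup-last (_ ∷ _ ∷ _)   zero    ()
  lookup-last (_ ∷ W)       (suc i) eq = lookup-last W i (ℕₚ.suc-injective eq)

  lookup-consecutive : Walk u l v → ∀ i j → suc (toℕ i) ≡ toℕ j → lookup l i ~ lookup l j
  lookup-consecutive [ _ ]   zero    zero    ()
  lookup-consecutive {u} (e ∷ W) zero (suc j) eq =
    subst (u ~_) (≡.sym (lookup-first W j (ℕₚ.suc-injective (≡.sym eq)))) e
  lookup-consecutive (_ ∷ W) (suc i) (suc j) eq = lookup-consecutive W i j (ℕₚ.suc-injective eq)

  closed-isCycle : Walk u l v → v ~ u → Unique l → 3 ≤ length l → IsCycle G (length l) (lookup l)
  closed-isCycle W vu un 3≤ = 3≤ , lookup-injective un , λ where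
    i j (inj₁ next)           → lookup-consecutive W i j next
    i j (inj₂ (last , first)) → ≡.subst₂ _~_
      (≡.sym (lookup-last W i last)) (≡.sym (lookup-first W j first)) vu

  cycle⇒IsCycle : 3 ≤ m → Cycle m c s p l → ∃ (IsCycle G m)
  cycle⇒IsCycle 3≤m (mkCycle W cs pc un refl) = _ , closed-isCycle (cs ∷ W) pc un 3≤m

  -- In the list `l₁ ++ l₂` the chord joins position 0 to position `length l₁`; both pieces have at
  -- least two vertices, so these positions are not consecutive.
  chorded⇒hasChord : ChordedCycle m → Σ (Fin m → V) λ c → IsCycle G m c × HasChord G m c
  chorded⇒hasChord (mkChorded {l₁ = l₁} W₁ yx W₂ yx′ xx long₁ long₂ un refl)
    with _ , refl ← source-first W₁ | _ , refl ← source-first W₂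
    with j , j≡ , at-j ← lookup-++ l₁ =
    _ , closed-isCycle (join W₁ yx W₂) yx′ un 3≤ ,
    zero , j , zero≢ j≡ long₁ , not-consecutive j≡ (Listₚ.length-++ l₁) long₁ long₂ ,
    subst (_ ~_) (≡.sym at-j) xx
    where
    3≤ = ℕₚ.≤-trans (ℕₚ.n≤1+n 3)
      (subst (4 ≤_) (≡.sym (Listₚ.length-++ l₁)) (ℕₚ.+-mono-≤ long₁ long₂))

  -- Claw-freeness and Z₂-freeness as case distinctions.

  module ClawFree (¬claw : ¬ InducedCopy claw G) where

    -- `R` stands for whatever each edge between two leaves is to produce, so that positive
    -- conclusions follow by cases on decidable adjacency. The leaves are assumed distinct because
    -- adjacency in the claw does not separate them.
    claw-edge : c ~ p → c ~ q → c ~ r → p ≢ q → p ≢ r → q ≢ r →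
                (p ~ q → R) → (p ~ r → R) → (q ~ r → R) → R
    claw-edge {c} {p} {q} {r} cp cq cr p≢q p≢r q≢r on-pq on-pr on-qr =
      byAdjacency p q on-pq λ ¬pq → byAdjacency p r on-pr λ ¬pr → byAdjacency q r on-qr λ ¬qr →
      let
        f : Fin 4 → V
        f = lookup (c ∷ p ∷ q ∷ r ∷ [])

        same : ∀ i j → adj G (f i) (f j) ≡ claw i j
        same = λ where
          zero zero                                         → irrefl G c
          zero (suc zero)                                   → cp
          zero (suc (suc zero))                             → cq
          zero (suc (suc (suc zero)))                       → cr
          (suc zero) zero                                   → ~-sym cp
          (suc zero) (suc zero)                             → irrefl G p
          (suc zero) (suc (suc zero))                       → ¬pq
          (suc zero) (suc (suc (suc zero)))                 → ¬pr
          (suc (suc zero)) zero                             → ~-sym cq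
          (suc (suc zero)) (suc zero)                       → trans (sym G q p) ¬pq
          (suc (suc zero)) (suc (suc zero))                 → irrefl G q
          (suc (suc zero)) (suc (suc (suc zero)))           → ¬qr
          (suc (suc (suc zero))) zero                       → ~-sym cr
          (suc (suc (suc zero))) (suc zero)                 → trans (sym G r p) ¬pr
          (suc (suc (suc zero))) (suc (suc zero))           → trans (sym G r q) ¬qr
          (suc (suc (suc zero))) (suc (suc (suc zero)))     → irrefl G r

        distinct : Unique (c ∷ p ∷ q ∷ r ∷ [])
        distinct = (~⇒≢ cp ∷ ~⇒≢ cq ∷ ~⇒≢ cr ∷ []) ∷ (p≢q ∷ p≢r ∷ []) ∷ (q≢r ∷ []) ∷ [] ∷ []

        injective : Injective _≡_ _≡_ f
        injective {i} {j} = lookup-injective distinct {i} {j}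
      in ⊥-elim (¬claw (f , injective ,
           λ i j → trans (same i j) , trans (≡.sym (same i j))))

  module Z₂Free (¬Z₂ : ¬ InducedCopy Z₂ G) where

    -- Distinctness of the five vertices comes from `Z₂-rows-distinct`, which leaves only the five
    -- nonadjacent pairs of `Z₂` as cases.
    Z₂-edge : a ~ b → a ~ c → b ~ c → x ~ a → y ~ x →
              (x ~ b → R) → (x ~ c → R) → (y ~ a → R) → (y ~ b → R) → (y ~ c → R) → R
    Z₂-edge {a} {b} {c} {x} {y} ab ac bc xa yx on-xb on-xc on-ya on-yb on-yc =
      byAdjacency x b on-xb λ ¬xb → byAdjacency x c on-xc λ ¬xc →
      byAdjacency y a on-ya λ ¬ya → byAdjacency y b on-yb λ ¬yb → byAdjacency y c on-yc λ ¬yc →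
      let
        f : Fin 5 → V
        f = lookup (a ∷ b ∷ c ∷ x ∷ y ∷ [])

        same : ∀ i j → adj G (f i) (f j) ≡ Z₂ i j
        same = λ where
          zero zero                                                 → irrefl G a
          zero (suc zero)                                           → ab
          zero (suc (suc zero))                                     → ac
          zero (suc (suc (suc zero)))                               → ~-sym xa
          zero (suc (suc (suc (suc zero))))                         → trans (sym G a y) ¬ya
          (suc zero) zero                                           → ~-sym ab
          (suc zero) (suc zero)                                     → irrefl G b
          (suc zero) (suc (suc zero))                               → bc
          (suc zero) (suc (suc (suc zero)))                         → trans (sym G b x) ¬xb
          (suc zero) (suc (suc (suc (suc zero))))                   → trans (sym G b y) ¬yb
          (suc (suc zero)) zero                                     → ~-sym ac
          (suc (suc zero)) (suc zero)                               → ~-sym bc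
          (suc (suc zero)) (suc (suc zero))                         → irrefl G c
          (suc (suc zero)) (suc (suc (suc zero)))                   → trans (sym G c x) ¬xc
          (suc (suc zero)) (suc (suc (suc (suc zero))))             → trans (sym G c y) ¬yc
          (suc (suc (suc zero))) zero                               → xa
          (suc (suc (suc zero))) (suc zero)                         → ¬xb
          (suc (suc (suc zero))) (suc (suc zero))                   → ¬xc
          (suc (suc (suc zero))) (suc (suc (suc zero)))             → irrefl G x
          (suc (suc (suc zero))) (suc (suc (suc (suc zero))))       → ~-sym yx
          (suc (suc (suc (suc zero)))) zero                         → ¬ya
          (suc (suc (suc (suc zero)))) (suc zero)                   → ¬yb
          (suc (suc (suc (suc zero)))) (suc (suc zero))             → ¬yc
          (suc (suc (suc (suc zero)))) (suc (suc (suc zero)))       → yx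
          (suc (suc (suc (suc zero)))) (suc (suc (suc (suc zero)))) → irrefl G y

        injective : Injective _≡_ _≡_ f
        injective {i} {j} fi≡fj = Z₂-rows-distinct i j λ k →
          trans (≡.sym (same i k)) (trans (cong (λ v → adj G v (f k)) fi≡fj) (same j k))
      in ⊥-elim (¬Z₂ (f , injective ,
           λ i j → trans (same i j) , trans (≡.sym (same i j))))

    -- Lengthening a cycle by one vertex.

    module Extend (¬claw : ¬ InducedCopy claw G) (4≤m : 4 ≤ m) where
      open ClawFree ¬claw

      -- Below, P → Longer plays the role of ¬ P, so that the argument by
      -- contradiction produces the longer cycle constructively.
      Longer : Set
      Longer = ChordedCycle (suc m)

      open CommutativeMonoidSolver (↭ₚ.++-commutativeMonoid {A = V}) using (solve; _⊕_; _⊜_)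

      2≤m : 2 ≤ m
      2≤m = ℕₚ.≤-trans (s≤s (s≤s z≤n)) 4≤m

      longer : Cycle m c s p l → x ∉ c ∷ l → k ↭ x ∷ c ∷ l → Unique k × length k ≡ suc m
      longer C x∉ k↭ = Unique-resp-↭ (↭-sym k↭) (∉⇒Unique x∉ (unique C)) ,
        trans (↭ₚ.↭-length k↭) (cong suc (size C))

      length≥2 : Cycle m c s p l → 2 ≤ length l
      length≥2 C = ℕₚ.≤-trans (s≤s (s≤s z≤n)) (ℕₚ.≤-pred (subst (4 ≤_) (≡.sym (size C)) 4≤m))

      insert : Cycle m c s p l → x ∉ c ∷ l → x ~ c → x ~ s → Longer
      insert C x∉ xc xs with un , len ← longer C x∉ (swap _ _ ↭-refl) =
        mkChorded (~-sym xc ∷ [ _ ]) xs (walk C) (p~c C) (c~s C) (s≤s (s≤s z≤n)) (length≥2 C) un len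

      insert′ : Cycle m c s p l → x ∉ c ∷ l → x ~ c → x ~ p → Longer
      insert′ C x∉ = insert (reverseCycle C) (∉-reverse x∉)

      -- Consider the claw at `c` with leaves `s`, `p`, `x`. An edge from `x` to `s` or `p` lets `x`
      -- be inserted, so only `s ~ p` is left to the continuation.
      bypass : Cycle m c s p l → x ∉ c ∷ l → x ~ c → (s ~ p → Longer) → Longer
      bypass C x∉ xc on-sp = claw-edge (c~s C) (~-sym (p~c C)) (~-sym xc)
        (ends-distinct (walk C) (length≥2 C) (tail (unique C)))
        (λ { refl → x∉ (there (source∈ (walk C))) })
        (λ { refl → x∉ (there (target∈ (walk C))) })
        on-sp (insert C x∉ xc ∘ ~-sym) (insert′ C x∉ xc ∘ ~-sym)

      rotate-↭ : (S : Split s l p d) → d ∷ Split.after S ++ c ∷ Split.before S ↭ c ∷ l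
      rotate-↭ {d = d} {c = c} (mkSplit {before} {after} _ _ _ _ refl) =
        solve 4 (λ d a c b → d ⊕ a ⊕ c ⊕ b ⊜ c ⊕ b ⊕ d ⊕ a) ↭-refl
          (d ∷ []) after (c ∷ []) before

      rotate : Cycle m c s p l → (S : Split s l p d) →
               Cycle m d (Split.succ S) (Split.pred S) (Split.after S ++ c ∷ Split.before S)
      rotate C S = mkCycle
        (join (Split.right S) (p~c C) (c~s C ∷ Split.left S)) (Split.d~succ S) (Split.pred~d S)
        (Unique-resp-↭ (↭-sym (rotate-↭ S)) (unique C))
        (trans (↭ₚ.↭-length (rotate-↭ S)) (size C))

      ∉-rotate : (S : Split s l p d) → x ∉ c ∷ l → x ∉ d ∷ Split.after S ++ c ∷ Split.before S
      ∉-rotate S x∉ = x∉ ∘ ↭ₚ.∈-resp-↭ (rotate-↭ S)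

      -- The new cycle is c x d s … d⁻ d⁺ … p, with chord d d⁺.
      no-skip : Cycle m c s p l → x ∉ c ∷ l → x ~ c → x ~ d → d ∈ l → d ~ s → Longer
      no-skip {c} {s} {p} {x = x} {d = d} C x∉ xc xd d∈ ds with d Finₚ.≟ s | d Finₚ.≟ p
      ... | yes refl | _ = ⊥-elim (~⇒≢ ds refl)
      ... | no _ | yes refl = insert′ C x∉ xc xd
      ... | no d≢s | no d≢p
          with S@(mkSplit {before} {after} L wd dh W refl) ← split (walk C) d∈ d≢s d≢p =
        -- Unless `x` fits next to `d`, the neighbours of `d` on the cycle are adjacent, so `d` can
        -- be moved to between `x` and `s`.
        bypass (rotate C S) (∉-rotate S x∉) xd λ hw →
        let un , len = longer C x∉ (solve 5
              (λ d b a c x → (d ⊕ b) ⊕ a ⊕ c ⊕ x ⊜ x ⊕ c ⊕ b ⊕ d ⊕ a) ↭-refl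
              (d ∷ []) before after (c ∷ []) (x ∷ []))
        in mkChorded (ds ∷ L) (~-sym hw) (join W (p~c C) (~-sym xc ∷ [ x ])) xd dh
             (s≤s (nonempty L)) (length-++≥2 after) un len

      no-skip′ : Cycle m c s p l → x ∉ c ∷ l → x ~ c → x ~ d → d ∈ l → d ~ p → Longer
      no-skip′ C x∉ xc xd d∈ = no-skip (reverseCycle C) (∉-reverse x∉) xc xd
        (↭ₚ.∈-resp-↭ (↭-sym (↭ₚ.↭-reverse _)) d∈)

      -- In the triangle `c s p` with the path `x d`, every extra edge other than `c d` already
      -- lengthens the cycle, by insertion or by `no-skip`.
      neighbours-adjacent : Cycle m c s p l → x ∉ c ∷ l → x ~ c → x ~ d → d ∈ l →
                            (c ~ d → Longer) → Longer
      neighbours-adjacent C x∉ xc xd d∈ on-cd = bypass C x∉ xc λ sp →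
        Z₂-edge (c~s C) (~-sym (p~c C)) sp xc (~-sym xd)
          (insert C x∉ xc) (insert′ C x∉ xc)
          (on-cd ∘ ~-sym) (no-skip C x∉ xc xd d∈) (no-skip′ C x∉ xc xd d∈)

      -- By Z₂-freeness for the triangle x c d, adjacency to c propagates from s
      -- along the cycle up to d⁻, which is impossible.
      two-neighbours : Cycle m c s p l → x ∉ c ∷ l → x ~ c → x ~ d → d ∈ l → Longer
      two-neighbours {c} {s} {p} {x = x} {d = d} C x∉ xc xd d∈ with d Finₚ.≟ s | d Finₚ.≟ p
      ... | yes refl | _ = insert C x∉ xc xd
      ... | no _ | yes refl = insert′ C x∉ xc xd
      ... | no d≢s | no d≢p
          with S@(mkSplit {before} {after} {d⁻} {d⁺} L wd dh W refl) ← split (walk C) d∈ d≢s d≢p =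
        -- `c ~ d` completes the triangle `x c d`; the edges `s p` and `d⁻ d⁺` let a cycle skip `c`
        -- and `d`.
        neighbours-adjacent C x∉ xc xd d∈ λ cd →
        bypass C x∉ xc λ sp →
        bypass D x∉D xd λ hw →
        start cd sp hw L refl
        where
        D = rotate C S
        x∉D = ∉-rotate S x∉

        -- The roles of `c` and `d` are exchanged: on the cycle based at `d`, the second neighbour
        -- of `x` is `c`.
        d⁻≁c : d⁻ ~ c → Longer
        d⁻≁c = no-skip′ D x∉D xd xc (∈ₚ.∈-++⁺ʳ after (here refl)) ∘ ~-sym

        module _ (cd : c ~ d) (sp : s ~ p) (hw : d⁺ ~ d⁻) where

          -- The new cycle is c x d u … d⁻ d⁺ … p s … q, with chord d d⁺.
          reroute : ∀ {P U} → Walk s P q → q ~ c → Walk u U d⁻ → before ≡ P ++ U → u ~ d → Longer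
          reroute {P = P} {U} V₁ qc V₂ refl ud =
            let un , len = longer C x∉ (solve 6
                  (λ d u a p c x → (d ⊕ u) ⊕ a ⊕ p ⊕ c ⊕ x ⊜ x ⊕ c ⊕ (p ⊕ u) ⊕ d ⊕ a) ↭-refl
                  (d ∷ []) U after P (c ∷ []) (x ∷ []))
            in mkChorded (~-sym ud ∷ V₂) (~-sym hw)
                 (join W (~-sym sp) (join V₁ qc (~-sym xc ∷ [ x ]))) xd dh
                 (s≤s (nonempty V₂))
                 (subst (λ k → 2 ≤ length k) (Listₚ.++-assoc after P _) (length-++≥2 (after ++ P)))
                 un len

          -- c and u are both neighbours of x, and q ~ c precedes u on the cycle.
          reopen : ∀ {P U} → Walk s P q → q ~ c → q ~ u → Walk u U d⁻ → before ≡ P ++ U → u ~ x → Longer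
          reopen {q} {u} {P} {U} V₁ qc qu V₂ refl ux =
            let mkThrough l≡ E = closeUp 2≤m around qu
                  (Unique-resp-↭ around-↭ (unique C))
                  (trans (≡.sym (↭ₚ.↭-length around-↭)) (size C))
                x∉u = x∉ ∘ ↭ₚ.∈-resp-↭ (↭-sym around-↭) ∘ subst (x ∈_) (≡.sym l≡)
                c∈u = subst (c ∈_) l≡ (∈ₚ.∈-++⁺ʳ U (there (∈ₚ.∈-++⁺ʳ after (here refl))))
            in no-skip′ E x∉u (~-sym ux) xc (Any.tail c≢u c∈u) (~-sym qc)
            where
            -- The given cycle read from `u`: `u … d⁻ d d⁺ … p c s … q`.
            around = join V₂ wd (dh ∷ join W (p~c C) (c~s C ∷ V₁))
            around-↭ : c ∷ (P ++ U) ++ d ∷ after ↭ U ++ d ∷ after ++ c ∷ P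
            around-↭ = solve 5 (λ c p u d a → c ⊕ (p ⊕ u) ⊕ d ⊕ a ⊜ u ⊕ d ⊕ a ⊕ c ⊕ p)
              ↭-refl (c ∷ []) P U (d ∷ []) after
            c≢u : c ≢ u
            c≢u refl = Unique[x∷xs]⇒x∉xs (unique C)
              (∈ₚ.∈-++⁺ˡ (∈ₚ.∈-++⁺ʳ P (source∈ V₂)))

          -- The invariant is that `q` is adjacent to `c`, but to neither `x` nor `d`. The triangle
          -- `c x d` with the path `q u` hands it on to `u`, and the recursion ends at `d⁻`.
          advance : ∀ {P U} → Walk s P q → q ~ c → (q ~ x → Longer) → (q ~ d → Longer) →
                    q ~ u → Walk u U d⁻ → before ≡ P ++ U → Longer
          advance {q} {u} {P} {U} V₁ qc q≁x q≁d qu V₂ eq =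
            Z₂-edge (~-sym xc) cd xd qc (~-sym qu) q≁x q≁d (next V₂ eq) u≁x u≁d
            where
            u≁x = reopen V₁ qc qu V₂ eq
            u≁d = reroute V₁ qc V₂ eq
            next : ∀ {U} → Walk u U d⁻ → before ≡ P ++ U → u ~ c → Longer
            next [ _ ] _ = d⁻≁c
            next (e ∷ V₂) eq uc = advance (join V₁ qu [ u ]) uc u≁x u≁d e V₂
              (trans eq (≡.sym (Listₚ.++-assoc P _ _)))

          start : ∀ {B} → Walk s B d⁻ → before ≡ B → Longer
          start [ _ ] _ = no-skip C x∉ xc xd d∈ (~-sym wd)
          start (e ∷ V₂) eq = advance [ s ] (~-sym (c~s C)) (insert C x∉ xc ∘ ~-sym)
            (no-skip C x∉ xc xd d∈ ∘ ~-sym) e V₂ eq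

      -- `rotate` reaches only vertices strictly between `s` and `p`. This moves the base to `s`
      -- itself, and after `reverseCycle` to `p`.
      record Shifted (c s p : V) (l : List V) : Set where
        constructor mkShifted
        field
          {s⁺}    : V
          {l⁻}    : List V
          l≡      : l ≡ s ∷ l⁻
          s~s⁺    : s ~ s⁺
          walk⁻   : Walk s⁺ l⁻ p
          shift-↭ : s ∷ l⁻ ++ c ∷ [] ↭ c ∷ l
          shifted : Cycle m s s⁺ c (l⁻ ++ c ∷ [])

      shift : Cycle m c s p l → Shifted c s p l
      shift {c} {s} {p} C with walk C | length≥2 C | unique C | size C
      ... | [ _ ] | s≤s () | _ | _
      ... | _∷_ {l = k} ss⁺ W | _ | un | len = mkShifted refl ss⁺ W S↭
              (mkCycle (join W (p~c C) [ c ]) ss⁺ (c~s C)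
                (Unique-resp-↭ (↭-sym S↭) un) (trans (↭ₚ.↭-length S↭) len))
        where
        S↭ : s ∷ k ++ c ∷ [] ↭ c ∷ s ∷ k
        S↭ = ↭ₚ.++-comm (s ∷ k) (c ∷ [])

      -- Here p, c, s and its successor s⁺ are pairwise adjacent, so the triangle
      -- c p s⁺ with the path x y is an induced Z₂.
      distant : Cycle m c s p l → x ∉ c ∷ l → y ∉ c ∷ l → x ~ c → y ~ x → y ~ s → Longer
      distant {x = x} C x∉ y∉ xc yx ys
          with mkShifted {s⁺} {k} refl ss⁺ W S↭ S ← shift C =
        let
          y∉S = y∉ ∘ ↭ₚ.∈-resp-↭ S↭
          -- Since `m` is at least 4, two or more vertices remain from `s⁺` to `p`, which makes
          -- these two distinct.
          k≥2 = ℕₚ.≤-pred (ℕₚ.≤-pred (subst (4 ≤_) (≡.sym (size C)) 4≤m))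
          x≁s⁺ = λ xs⁺ → no-skip C x∉ xc xs⁺ (there (source∈ W)) (~-sym ss⁺)
        in
        -- The neighbour `y` of `s` yields `s⁺ ~ c`; then the claw at `c` with leaves `x`, `p`, `s⁺`
        -- yields `p ~ s⁺`.
        bypass S y∉S ys λ s⁺c →
        claw-edge (~-sym xc) (~-sym (p~c C)) (~-sym s⁺c)
          (λ { refl → x∉ (there (there (target∈ W))) })
          (λ { refl → x∉ (there (there (source∈ W))) })
          (≡.≢-sym (ends-distinct W k≥2 (tail (tail (unique C)))))
          (insert′ C x∉ xc) x≁s⁺ λ ps⁺ →
        Z₂-edge (~-sym (p~c C)) (~-sym s⁺c) ps⁺ xc yx
          (insert′ C x∉ xc) x≁s⁺
          (insert′ S y∉S ys)
          (λ yp → no-skip′ S y∉S ys yp (∈ₚ.∈-++⁺ˡ (target∈ W)) (p~c C))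
          (insert S y∉S ys)

      -- Induction along the walk. If its next vertex `y` is on the cycle, `x` has two neighbours
      -- there. If not, the triangle `c s p` with the path `x y` leaves `y ~ c`, where the induction
      -- continues from `y`, or `y` adjacent to `s` or `p`, which is `distant`.
      escape : Cycle m c s p l → x ∉ c ∷ l → x ~ c → ReachIn G (_≢ c) x s → Longer
      escape C x∉ xc (here _) = ⊥-elim (x∉ (there (source∈ (walk C))))
      escape {c} {l = l} C x∉ xc (step {v = y} _ xy rest) with y ∈? (c ∷ l)
      ... | yes (here refl) = ⊥-elim (start≢ rest refl)
      ... | yes (there y∈) = two-neighbours C x∉ xc xy y∈
      ... | no y∉ = bypass C x∉ xc λ sp →
        Z₂-edge (c~s C) (~-sym (p~c C)) sp xc (~-sym xy)
          (insert C x∉ xc) (insert′ C x∉ xc)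
          (λ yc → escape C y∉ yc rest)
          (distant C x∉ y∉ xc (~-sym xy))
          (distant (reverseCycle C) (∉-reverse x∉) (∉-reverse y∉) xc (~-sym xy))

      -- A walk from an uncovered vertex to `c` enters the cycle somewhere. The cycle is rebased at
      -- the entry vertex, and 2-connectedness supplies a walk avoiding that vertex for `escape`.
      -- The new cycle gets its chord from the rerouting.
      extend : TwoConnected G → m < n → Cycle m c s p l → Longer
      extend {c} {s} {p} {l} (_ , connected , 2-connected) m<n C
          with v , v∉ ← uncovered (c ∷ l) (subst (_< n) (≡.sym (size C)) m<n) =
        search (connected v c) v∉
        where
        escapeAt : ∀ {x y s p l} → Cycle m y s p l → x ∉ y ∷ l → x ~ y → Longer
        escapeAt C x∉ xy = escape C x∉ xy
          (2-connected _ _ _ (~⇒≢ xy) (≡.≢-sym (~⇒≢ (c~s C))))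

        leave : ∀ {x y} → x ∉ c ∷ l → x ~ y → y ∈ c ∷ l → Longer
        leave x∉ xy (here refl) = escapeAt C x∉ xy
        leave {y = y} x∉ xy (there y∈) with y Finₚ.≟ s | y Finₚ.≟ p
        ... | no y≢s | no y≢p = let S = split (walk C) y∈ y≢s y≢p in
          escapeAt (rotate C S) (∉-rotate S x∉) xy
        ... | yes refl | _ = let S = shift C in
          escapeAt (Shifted.shifted S) (x∉ ∘ ↭ₚ.∈-resp-↭ (Shifted.shift-↭ S)) xy
        ... | no _ | yes refl = let S = shift (reverseCycle C) in
          escapeAt (Shifted.shifted S) (∉-reverse x∉ ∘ ↭ₚ.∈-resp-↭ (Shifted.shift-↭ S)) xy

        search : ∀ {v} → ReachIn G (λ _ → ⊤) v c → v ∉ c ∷ l → Longer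
        search (here _) v∉ = ⊥-elim (v∉ (here refl))
        search (step {v = w} _ vw rest) v∉ with w ∈? (c ∷ l)
        ... | yes w∈ = leave v∉ vw w∈
        ... | no w∉  = search rest w∉

      chorded⇒longer : TwoConnected G → m < n → ChordedCycle m → Longer
      chorded⇒longer conn m<n (mkChorded W₁ yx W₂ yx′ _ _ _ un len) =
        extend conn m<n (Through.cycle (closeUp 2≤m (join W₁ yx W₂) yx′ un len))

    -- Diamonds: an edge in two triangles is a chord of a 4-cycle.

    diamond : a ~ b → c ~ a → c ~ b → d ~ a → d ~ b → c ≢ d → ChordedCycle 4
    diamond ab ca cb da db c≢d = mkChorded (~-sym ca ∷ [ _ ]) cb (~-sym db ∷ [ _ ]) da ab
      (s≤s (s≤s z≤n)) (s≤s (s≤s z≤n))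
      ((≡.≢-sym (~⇒≢ ca) ∷ ~⇒≢ ab ∷ ≡.≢-sym (~⇒≢ da) ∷ []) ∷ (~⇒≢ cb ∷ c≢d ∷ []) ∷
       (≡.≢-sym (~⇒≢ db) ∷ []) ∷ [] ∷ [])
      refl

    module Base (¬claw : ¬ InducedCopy claw G) where
      open ClawFree ¬claw

      Outer : V → V → V → V → Set
      Outer a b c x = x ~ a × x ≢ b × x ≢ c

      outer? : ∀ a b c x → Dec (Outer a b c x)
      outer? a b c x = (x ~? a) ×-dec ¬? (x Finₚ.≟ b) ×-dec ¬? (x Finₚ.≟ c)

      outer : V → V → V → List V
      outer a b c = filter (outer? a b c) (allFin n)

      -- Let `x`, `y`, `z` be three outer neighbours of `a`. An edge from `b` to one of them puts
      -- `a b` in a second triangle. Otherwise claws at `a` give `x ~ y` and `x ~ z`, so `a x` lies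
      -- in two triangles.
      crowded : a ~ b → a ~ c → b ~ c → Unique l → All (Outer a b c) l →
                ChordedCycle 4 ⊎ length l ≤ 2
      crowded _ _ _ _ []            = inj₂ z≤n
      crowded _ _ _ _ (_ ∷ [])      = inj₂ (s≤s z≤n)
      crowded _ _ _ _ (_ ∷ _ ∷ [])  = inj₂ (s≤s (s≤s z≤n))
      crowded {a} {b} {c} ab ac bc ((x≢y ∷ x≢z ∷ _) ∷ (y≢z ∷ _) ∷ _)
              (X@(xa , x≢b , _) ∷ Y@(ya , y≢b , _) ∷ Z@(za , z≢b , _) ∷ _) = inj₁
        (claw-edge ab (~-sym xa) (~-sym ya) (≡.≢-sym x≢b) (≡.≢-sym y≢b) x≢y (share X) (share Y) λ xy →
         claw-edge ab (~-sym xa) (~-sym za) (≡.≢-sym x≢b) (≡.≢-sym z≢b) x≢z (share X) (share Z) λ xz →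
         diamond (~-sym xa) ya (~-sym xy) za (~-sym xz) y≢z)
        where
        share : Outer a b c x → b ~ x → ChordedCycle 4
        share (xa , _ , x≢c) bx = diamond ab xa (~-sym bx) (~-sym ac) (~-sym bc) x≢c

      outer-short : a ~ b → a ~ c → b ~ c → ChordedCycle 4 ⊎ length (outer a b c) ≤ 2
      outer-short {a} {b} {c} ab ac bc = crowded ab ac bc
        (filter⁺ (outer? a b c) (allFin⁺ n)) (Allₚ.all-filter (outer? a b c) (allFin n))

      -- Z₂-freeness gives `x` a second neighbour on the triangle. The edge joining its two
      -- neighbours then lies in two triangles, as `x` differs from the third vertex, to which `y`
      -- is not adjacent.
      step-away : a ~ b → a ~ c → b ~ c → x ~ a → y ~ x → ¬ y ~ a → ¬ y ~ b → ¬ y ~ c →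
                  ChordedCycle 4
      step-away ab ac bc xa yx ¬ya ¬yb ¬yc = Z₂-edge ab ac bc xa yx
        (λ xb → diamond ab xa xb (~-sym ac) (~-sym bc) λ { refl → ¬yc yx })
        (λ xc → diamond ac xa xc (~-sym ab) bc λ { refl → ¬yb yx })
        (⊥-elim ∘ ¬ya) (⊥-elim ∘ ¬yb) (⊥-elim ∘ ¬yc)

      module _ (ab : a ~ b) (ac : a ~ c) (bc : b ~ c) where

        Near : V → Set
        Near v = Any (λ t → v ≡ t ⊎ v ~ t) (a ∷ b ∷ c ∷ [])

        near? : ∀ v → Dec (Near v)
        near? v = Any.any? (λ t → (v Finₚ.≟ t) ⊎-dec (v ~? t)) _

        near-step : Near x → y ~ x → ¬ Near y → ChordedCycle 4
        near-step {x} {y} near yx ¬near = case near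
          where
          ¬ya = λ ya → ¬near (here (inj₂ ya))
          ¬yb = λ yb → ¬near (there (here (inj₂ yb)))
          ¬yc = λ yc → ¬near (there (there (here (inj₂ yc))))
          case : Near x → ChordedCycle 4
          case (here (inj₁ refl))                 = ⊥-elim (¬ya yx)
          case (there (here (inj₁ refl)))         = ⊥-elim (¬yb yx)
          case (there (there (here (inj₁ refl)))) = ⊥-elim (¬yc yx)
          case (here (inj₂ xa))                   = step-away ab ac bc xa yx ¬ya ¬yb ¬yc
          case (there (here (inj₂ xb)))           = step-away (~-sym ab) bc ac xb yx ¬yb ¬ya ¬yc
          case (there (there (here (inj₂ xc))))   =
            step-away (~-sym ac) (~-sym bc) ab xc yx ¬yc ¬ya ¬yb

        -- Somewhere the walk to `a` steps from a vertex that is not near to a near one, where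
        -- `near-step` applies.
        far : ReachIn G (λ _ → ⊤) v a → ¬ Near v → ChordedCycle 4
        far (here _) ¬near = ⊥-elim (¬near (here (inj₁ refl)))
        far (step {v = w} _ vw rest) ¬near with near? w
        ... | yes near = near-step near vw ¬near
        ... | no ¬near′ = far rest ¬near′

        near-all : (∀ v → Near v) → 10 ≤ n → ChordedCycle 4
        near-all near 10≤n
            with outer-short ab ac bc | outer-short (~-sym ab) bc ac
               | outer-short (~-sym ac) (~-sym bc) ab
        ... | inj₁ C | _ | _ = C
        ... | inj₂ _ | inj₁ C | _ = C
        ... | inj₂ _ | inj₂ _ | inj₁ C = C
        ... | inj₂ a≤2 | inj₂ b≤2 | inj₂ c≤2 =
          ⊥-elim (ℕₚ.1+n≰n (ℕₚ.≤-trans 10≤n (ℕₚ.≤-trans (covers⇒≤ covers) 3+6≤9)))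
          where
          Oa = outer a b c
          Ob = outer b a c
          Oc = outer c a b

          3+6≤9 : 3 + length (Oa ++ Ob ++ Oc) ≤ 9
          3+6≤9 = ℕₚ.+-monoʳ-≤ 3 (begin
            length (Oa ++ Ob ++ Oc)              ≡⟨ Listₚ.length-++ Oa ⟩
            length Oa + length (Ob ++ Oc)        ≡⟨ cong (length Oa +_) (Listₚ.length-++ Ob) ⟩
            length Oa + (length Ob + length Oc)  ≤⟨ ℕₚ.+-mono-≤ a≤2 (ℕₚ.+-mono-≤ b≤2 c≤2) ⟩
            6                                 ∎)
            where open ℕₚ.≤-Reasoning

          covers : ∀ v → v ∈ a ∷ b ∷ c ∷ Oa ++ Ob ++ Oc
          covers v with v ∈? (a ∷ b ∷ c ∷ [])
          ... | yes v∈ = ∈ₚ.∈-++⁺ˡ v∈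
          ... | no v∉ = ∈ₚ.∈-++⁺ʳ (a ∷ b ∷ c ∷ []) (place (near v))
            where
            v≢a = v∉ ∘ here
            v≢b = v∉ ∘ there ∘ here
            v≢c = v∉ ∘ there ∘ there ∘ here
            listed : ∀ {t r q} → Outer t r q v → v ∈ outer t r q
            listed = ∈ₚ.∈-filter⁺ (outer? _ _ _) (∈ₚ.∈-allFin v)
            place : Near v → v ∈ Oa ++ Ob ++ Oc
            place (here (inj₁ eq))                 = ⊥-elim (v≢a eq)
            place (there (here (inj₁ eq)))         = ⊥-elim (v≢b eq)
            place (there (there (here (inj₁ eq)))) = ⊥-elim (v≢c eq)
            place (here (inj₂ va))                 = ∈ₚ.∈-++⁺ˡ (listed (va , v≢b , v≢c))
            place (there (here (inj₂ vb)))         =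
              ∈ₚ.∈-++⁺ʳ Oa (∈ₚ.∈-++⁺ˡ (listed (vb , v≢a , v≢c)))
            place (there (there (here (inj₂ vc)))) =
              ∈ₚ.∈-++⁺ʳ Oa (∈ₚ.∈-++⁺ʳ Ob (listed (vc , v≢a , v≢b)))

        triangle⇒diamond : Connected G → 10 ≤ n → ChordedCycle 4
        triangle⇒diamond connected 10≤n with Finₚ.all? near?
        ... | yes near = near-all near 10≤n
        ... | no ¬near with v , ¬near-v ← Finₚ.¬∀⟶∃¬ n _ near? ¬near = far (connected v a) ¬near-v

  -- Paths and a first cycle from 2-connectedness.

  suffix : Walk u l v → w ∈ l → Unique l → ∃ λ k → Walk w k v × Unique k × (∀ {x} → x ∈ k → x ∈ l)
  suffix W@([ _ ]) (here refl) un = _ , W , un , id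
  suffix W@(_ ∷ _) (here refl) un = _ , W , un , id
  suffix (_ ∷ W) (there w∈) (_ ∷ un) with k , W′ , un′ , k⊆l ← suffix W w∈ un =
    k , W′ , un′ , there ∘ k⊆l

  -- Loop erasure: if `u` already lies on the path found from `v`, that path is cut back to start at
  -- `u`.
  reach⇒path : ReachIn G (_≢ c) u w → ∃ λ l → Walk u l w × Unique (c ∷ l)
  reach⇒path (here u≢c) = _ , [ _ ] , ∉⇒Unique (λ { (here refl) → u≢c refl }) ([] ∷ [])
  reach⇒path {c} {u} (step u≢c uv rest) with l , W , un ← reach⇒path rest with u ∈? l
  ... | no u∉ = u ∷ l , uv ∷ W , ∉⇒Unique
    (λ { (here refl) → u≢c refl ; (there c∈) → Unique[x∷xs]⇒x∉xs un c∈ })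
    (∉⇒Unique u∉ (tail un))
  ... | yes u∈ with k , W′ , un′ , k⊆l ← suffix W u∈ (tail un) =
    k , W′ , ∉⇒Unique (Unique[x∷xs]⇒x∉xs un ∘ k⊆l) un′

  first-step : ∀ {S} → ReachIn G S u w → u ≢ w → ∃ λ v → u ~ v × ReachIn G S v w
  first-step (here _) u≢w = ⊥-elim (u≢w refl)
  first-step (step _ uv rest) _ = _ , uv , rest

  -- A walk from `v` that avoids its neighbour `u` must leave `v` by another edge; a third vertex
  -- `r` serves as its destination.
  two-edges : TwoConnected G → ∃ λ v → ∃ λ u → ∃ λ w → v ~ u × v ~ w × w ≢ u
  two-edges (3≤n , connected , 2-connected)
    with v , _ ← uncovered [] (ℕₚ.≤-trans (s≤s z≤n) 3≤n)
    with t , t∉ ← uncovered (v ∷ []) (ℕₚ.≤-trans (s≤s (s≤s z≤n)) 3≤n)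
    with u , vu , _ ← first-step (connected v t) (λ { refl → t∉ (here refl) })
    with r , r∉ ← uncovered (v ∷ u ∷ []) 3≤n
    with w , vw , rest ← first-step
           (2-connected u v r (~⇒≢ vu) (λ { refl → r∉ (there (here refl)) }))
           (λ { refl → r∉ (here refl) }) =
    v , u , w , vu , vw , start≢ rest

  -- The triangle-free case.

  module TriangleFree (no-triangle : ∀ {a b c} → a ~ b → a ~ c → b ~ c → ⊥) where

    path⇒cycle : v ~ u → v ~ w → w ≢ u → Walk u l w → Unique (v ∷ l) →
                 4 ≤ suc (length l) × Cycle (suc (length l)) v u w l
    path⇒cycle {v} {u} {w} vu vw w≢u W un = s≤s (size≥3 W) , mkCycle W vu (~-sym vw) un refl
      where
      -- A path of one vertex would make `u` and `w` equal, and one of two vertices would close a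
      -- triangle with `v`.
      size≥3 : ∀ {l} → Walk u l w → 3 ≤ length l
      size≥3 [ _ ]           = ⊥-elim (w≢u refl)
      size≥3 (uw ∷ [ _ ])    = ⊥-elim (no-triangle vu vw uw)
      size≥3 (_ ∷ _ ∷ [ _ ]) = s≤s (s≤s (s≤s z≤n))
      size≥3 (_ ∷ _ ∷ _ ∷ _) = s≤s (s≤s (s≤s z≤n))

    long-cycle : TwoConnected G →
                 ∃ λ m → ∃ λ c → ∃ λ s → ∃ λ p → ∃ λ l → 4 ≤ m × Cycle m c s p l
    long-cycle conn@(_ , _ , 2-connected) =
      let v , u , w , vu , vw , w≢u = two-edges conn
          l , W , un = reach⇒path (2-connected v u w (≡.≢-sym (~⇒≢ vu)) (≡.≢-sym (~⇒≢ vw)))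
      in _ , _ , _ , _ , _ , path⇒cycle vu vw w≢u W un

    -- At an end `i` of a chord, the other end and the two cycle neighbours of `i` are distinct, and
    -- pairwise nonadjacent for lack of triangles: a claw.
    hamiltonian⇒cycleGraph : ¬ InducedCopy claw G → ∃ (IsCycle G n) → IsCycleGraph G
    hamiltonian⇒cycleGraph ¬claw (f , 3≤n , injective , edges) =
      f , (injective , surjective) , λ i j → cyclic⇒edge i j , edge⇒cyclic i j
      where
      open ClawFree ¬claw

      cyclic⇒edge : ∀ i j → CycAdj n i j → f i ~ f j
      cyclic⇒edge i j (inj₁ ij) = edges i j ij
      cyclic⇒edge i j (inj₂ ji) = ~-sym (edges j i ji)

      edge⇒cyclic : ∀ i j → f i ~ f j → CycAdj n i j
      edge⇒cyclic i j ij with consecutive? i j | successor i | predecessor i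
      ... | yes adjacent | _ | _ = adjacent
      ... | no ¬adjacent | i⁺ , next | i⁻ , previous = ⊥-elim (claw-edge
        (edges i i⁺ next) (~-sym (edges i⁻ i previous)) ij
        (λ eq → no-2-cycle 3≤n next (subst (λ j → CycSucc n j i) (≡.sym (injective eq)) previous))
        (λ eq → ¬adjacent (inj₁ (subst (CycSucc n i) (injective eq) next)))
        (λ eq → ¬adjacent (inj₂ (subst (λ j → CycSucc n j i) (injective eq) previous)))
        (no-triangle (edges i i⁺ next) (~-sym (edges i⁻ i previous)))
        (no-triangle (edges i i⁺ next) ij)
        (no-triangle (~-sym (edges i⁻ i previous)) ij))

      surjective : Surjective _≡_ _≡_ f
      surjective y with Finₚ.any? (λ i → f i Finₚ.≟ y)
      ... | yes (i , fi≡y) = i , λ { refl → fi≡y }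
      -- A missed vertex together with the values of `f` would make `n + 1` distinct vertices.
      ... | no y∉f = ⊥-elim (ℕₚ.1+n≰n (subst (_≤ n) (cong suc (Listₚ.length-tabulate f))
        (Finₚ.injective⇒≤ (lookup-injective (∉⇒Unique
          (λ y∈ → let i , y≡fi = ∈ₚ.∈-tabulate⁻ y∈ in y∉f (i , ≡.sym y≡fi))
          (tabulate⁺ injective))))))

-- Growth to every length, with and without a triangle.

theorem7 : (n : ℕ) (G : Graph n) → 10 ≤ n → TwoConnected G →
    ¬ InducedCopy claw G → ¬ InducedCopy Z₂ G →
    IsCycleGraph G ⊎ ChordedPancyclic G
theorem7 n G 10≤n conn@(_ , connected , _) ¬claw ¬Z₂ = result
  where
  open InGraph G
  open Z₂Free ¬Z₂

  grow : ∀ {m} → 4 ≤ m → ChordedCycle m → ∀ k → m + k ≤ n → ChordedCycle (m + k)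
  grow {m} _ C zero m+0≤n = subst ChordedCycle (≡.sym (ℕₚ.+-identityʳ m)) C
  grow {m} 4≤m C (suc k) m+k<n = subst ChordedCycle (≡.sym (ℕₚ.+-suc m k))
    (Extend.chorded⇒longer ¬claw (ℕₚ.≤-trans 4≤m (ℕₚ.m≤m+n m k)) conn m+k≤n
      (grow 4≤m C k (ℕₚ.<⇒≤ m+k≤n)))
    where
    m+k≤n : m + k < n
    m+k≤n = subst (_≤ n) (ℕₚ.+-suc m k) m+k<n

  grow-to : ∀ {m r} → 4 ≤ m → ChordedCycle m → m ≤ r → r ≤ n → ChordedCycle r
  grow-to {m} {r} 4≤m C m≤r r≤n with eq ← ℕₚ.m+[n∸m]≡n m≤r =
    subst ChordedCycle eq (grow 4≤m C (r ℕ.∸ m) (subst (_≤ n) (≡.sym eq) r≤n))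

  result : IsCycleGraph G ⊎ ChordedPancyclic G
  result with Finₚ.any? (λ a → Finₚ.any? λ b → Finₚ.any? λ c → (a ~? b) ×-dec (a ~? c) ×-dec (b ~? c))
  ... | yes (a , b , c , ab , ac , bc) = inj₂ λ m 4≤m m≤n → chorded⇒hasChord
    (grow-to ℕₚ.≤-refl (Base.triangle⇒diamond ¬claw ab ac bc connected 10≤n) 4≤m m≤n)
  ... | no ¬triangle = inj₁ (hamiltonian⇒cycleGraph ¬claw hamiltonian)
    where
    open TriangleFree (λ ab ac bc → ¬triangle (_ , _ , _ , ab , ac , bc))

    -- One extension already supplies a chord, so `grow-to` leads on to length `n`, where the chord
    -- is forgotten.
    span : ∀ {m c s p l} → 4 ≤ m → Cycle m c s p l → ∃ (IsCycle G n)
    span {m} 4≤m C with m ℕₚ.<? n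
    ... | yes m<n =
      let c , cycle , _ = chorded⇒hasChord (grow-to (ℕₚ.m≤n⇒m≤1+n 4≤m)
                            (Extend.extend ¬claw 4≤m conn m<n C) m<n ℕₚ.≤-refl)
      in c , cycle
    ... | no m≮n = subst (λ m → ∃ (IsCycle G m)) (ℕₚ.≤-antisym m≤n (ℕₚ.≮⇒≥ m≮n))
                     (cycle⇒IsCycle (ℕₚ.≤-trans (ℕₚ.n≤1+n 3) 4≤m) C)
      where
      m≤n : m ≤ n
      m≤n = subst (_≤ n) (Cycle.size C)
        (Finₚ.injective⇒≤ (lookup-injective (Cycle.unique C)))

    hamiltonian : ∃ (IsCycle G n)
    hamiltonian = let _ , _ , _ , _ , _ , 4≤m , C = long-cycle conn in span 4≤m C
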